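{- Let $m,s,p,n$ be nonnegative integers with $n\geq p$ and $m\geq 1$, and let $x$ be a complex number with $x\neq -1,-2,\ldots$. Then $$ \sum_{k=p}^{n} (-1)^{k-1}\binom{n}{k}\binom{k}{p} H_{mk+s}(x)= \begin{cases} \dfrac{(-1)^{p}\,m^{n-p-1}\,n!}{(n-p)\,p!}\displaystyle\sum_{i=1}^{m}\frac{1}{\prod_{u=p}^{n-1}(mu+s+x+i)}, & n>p,\\[12pt] (-1)^{p-1}H_{mp+s}(x), & n=p. \end{cases} $$
   Context: For an integer $n\geq 1$ and $x\neq -1,-2,\ldots$, define $H_n(x)=\sum_{k=1}^{n}\frac{1}{k+x}$; for $n\leq 0$ set $H_n(x)=0$. -}

module Defs where

open import Algebra.Apartness.Bundles using (HeytingField; HeytingCommutativeRing)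
open import Algebra.Bundles using (CommutativeRing; Semiring)
open import Data.Fin.Base using (zero; suc; toℕ)
open import Data.Integer.Base using (ℤ; +_; -[1+_])
open import Data.Nat.Base as ℕ using (ℕ; zero; suc; NonZero; _!)
import Data.Nat.Properties as ℕ
open import Data.Product.Base using (_,_; proj₁; proj₂)
open import Data.Vec.Functional using (Vector)

import Algebra.Apartness.Properties.HeytingCommutativeRing as HeytingProperties
import Algebra.Definitions.RawSemiring as RawSemiringDefinitions
import Algebra.Properties.Ring as RingProperties
import Algebra.Properties.Semiring.Mult as MultProperties

-- The standard library has no complex numbers.  Everything is developed over an
-- arbitrary field in the constructive sense: x # y plays the role of x ≠ y, and
-- it is what makes x - y invertible.  Reading _#_ as the negation of _≈_ turns
-- any classical field, in particular the complex numbers, into such a field.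
module HarmonicSums {c ℓ₁ ℓ₂} (F : HeytingField c ℓ₁ ℓ₂) where

  open HeytingField F hiding (zero)
  open HeytingCommutativeRing heytingCommutativeRing using (commutativeRing)
  open CommutativeRing commutativeRing using (ring; semiring)
  open HeytingProperties heytingCommutativeRing
    using (1#0; x#0y#0→xy#0; #-congʳ; x-0≈x)
  open RingProperties ring using (-‿involutive)
  open MultProperties semiring using (×-homo-+)
  open RawSemiringDefinitions (Semiring.rawSemiring semiring) using (_×_; _^_; sum; product)

  fromℕ : ℕ → Carrier
  fromℕ n = n × 1#

  CharacteristicZero : Set ℓ₂
  CharacteristicZero = ∀ n → .{{NonZero n}} → fromℕ n # 0#

  NotNegativeInteger : Carrier → Set ℓ₂
  NotNegativeInteger x = ∀ k → .{{NonZero k}} → x # - fromℕ k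

  -- #⇒invertible supplies an inverse of x - 0#, and x - 0# ≈ x.
  inverse : (x : Carrier) → x # 0# → Carrier
  inverse x x#0 = proj₁ (#⇒invertible x#0)

  infixl 7 _/_[_]
  _/_[_] : (x y : Carrier) → y # 0# → Carrier
  x / y [ y#0 ] = x * inverse y y#0

  power : (x : Carrier) → x # 0# → ℤ → Carrier
  power x x#0 (+ n)    = x ^ n
  power x x#0 -[1+ n ] = inverse x x#0 ^ suc n

  -1#0 : - 1# # 0#
  -1#0 = invertible⇒# (- 1# , lemma , trans (*-comm _ _) lemma)
    where
    lemma : - 1# * (- 1# - 0#) ≈ 1#
    lemma = trans (*-congˡ (x-0≈x (- 1#)))
           (trans (RingProperties.-1*x≈-x ring (- 1#)) (-‿involutive 1#))

  -- The exponents k - 1 and p - 1 can be -1, hence integer powers.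
  -1^_ : ℤ → Carrier
  -1^ z = power (- 1#) -1#0 z

  -- Both ranges are half-open: a, a + 1, …, b - 1 (empty when b ≤ a).

  infix 6 sum-syntax product-syntax

  sum-syntax : ℕ → ℕ → (ℕ → Carrier) → Carrier
  sum-syntax a b f = sum {n = b ℕ.∸ a} (λ j → f (a ℕ.+ toℕ j))

  product-syntax : ℕ → ℕ → (ℕ → Carrier) → Carrier
  product-syntax a b f = product {n = b ℕ.∸ a} (λ j → f (a ℕ.+ toℕ j))

  syntax sum-syntax     a b (λ k → e) = ∑[ a ≤ k < b ] e
  syntax product-syntax a b (λ k → e) = ∏[ a ≤ k < b ] e

  product#0 : ∀ {n} (v : Vector Carrier n) → (∀ j → v j # 0#) → product v # 0#
  product#0 {zero}  v v#0 = 1#0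
  product#0 {suc n} v v#0 =
    x#0y#0→xy#0 (v#0 zero) (product#0 (λ j → v (suc j)) (λ j → v#0 (suc j)))

  ∏#0 : ∀ a b (f : ℕ → Carrier) → (∀ k → f k # 0#) → product-syntax a b f # 0#
  ∏#0 a b f f#0 = product#0 {n = b ℕ.∸ a} _ (λ j → f#0 (a ℕ.+ toℕ j))

  k+x#0 : ∀ {x} → NotNegativeInteger x → ∀ k → .{{NonZero k}} → fromℕ k + x # 0#
  k+x#0 {x} x≠ k = invertible⇒# (proj₁ inv , lemma , trans (*-comm _ _) lemma)
    where
    inv = #⇒invertible (x≠ k)
    lemma : proj₁ inv * (fromℕ k + x - 0#) ≈ 1#
    lemma = trans (*-congˡ (trans (x-0≈x _) (trans (+-comm _ _)
              (+-congˡ (sym (-‿involutive _)))))) (proj₁ (proj₂ inv))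

  l+x+i#0 : ∀ {x} → NotNegativeInteger x → ∀ l i → .{{NonZero i}} →
            fromℕ l + x + fromℕ i # 0#
  l+x+i#0 {x} x≠ l i = #-congʳ lemma (k+x#0 x≠ (i ℕ.+ l) {{i+l≢0}})
    where
    i+l≢0 : NonZero (i ℕ.+ l)
    i+l≢0 = ℕ.>-nonZero (ℕ.≤-trans (ℕ.>-nonZero⁻¹ i) (ℕ.m≤m+n i l))
    lemma : fromℕ (i ℕ.+ l) + x ≈ fromℕ l + x + fromℕ i
    lemma = trans (+-congʳ (×-homo-+ 1# i l)) (trans (+-assoc _ _ _) (+-comm _ _))

  [n∸p]*p!#0 : CharacteristicZero → ∀ {p n} → p ℕ.< n →
               fromℕ ((n ℕ.∸ p) ℕ.* p !) # 0#
  [n∸p]*p!#0 char0 {p} {n} p<n = char0 ((n ℕ.∸ p) ℕ.* p !) {{nonZero}}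
    where
    nonZero : NonZero ((n ℕ.∸ p) ℕ.* p !)
    nonZero = ℕ.m*n≢0 (n ℕ.∸ p) (p !) {{ℕ.>-nonZero (ℕ.m<n⇒0<n∸m p<n)}} {{p ℕ.!≢0}}

  -- The sum of 1 / (k + x) over k = 1, …, n, indexed by j = k - 1.
  H : ℤ → (x : Carrier) → NotNegativeInteger x → Carrier
  H (+ n)    x x≠ =
    ∑[ 0 ≤ j < n ] (1# / (fromℕ (suc j) + x) [ k+x#0 x≠ (suc j) ])
  H -[1+ n ] x x≠ = 0#

{-# OPTIONS --safe #-}

-- By C(n,k) C(k,p) = C(n,p) C(n-p,k-p), the left-hand side is, up to the factor
-- (-1)^(p-1) C(n,p), the alternating binomial sum of order n - p of the sequence
-- k ↦ H_{m(p+k)+s}(x), that is, its iterated difference at 0.  One difference turns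
-- this sequence into -∑ᵢ 1/(m(p+k)+s+x+i), and the iterated difference of order M of
-- the reciprocals of an arithmetic progression y₀, y₁, … with step d is
-- M! dᴹ / (y₀ ⋯ y_M).
module Submission where

open import Defs
open import Algebra.Apartness.Bundles using (HeytingField; HeytingCommutativeRing)
open import Algebra.Bundles using (CommutativeRing; Semiring)
open import Data.Fin.Base using (toℕ)
import Data.Fin.Properties as Fin
open import Data.Integer.Base as ℤ using (+_)
open import Data.Nat.Base as ℕ using (ℕ; zero; suc; _∸_; _!; _≤_; _<_; z≤n; s≤s)
open import Data.Nat.Combinatorics
  using (_C_; nCk≡n!/k![n-k]!; k![n∸k]!∣n!; nCk+nC[k+1]≡[n+1]C[k+1]; nCn≡1; nCk≡nC[n∸k])
open import Data.Nat.DivMod using (m/n*n≡m)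
import Data.Nat.Properties as ℕ
open import Data.Nat.Tactic.RingSolver using (solve)
open import Data.List.Base using (_∷_; [])
open import Data.Product.Base using (_×_; _,_; proj₂)
open import Function.Base using (_∘_)
open import Relation.Binary.PropositionalEquality.Core as ≡ using (_≡_)
import Relation.Binary.PropositionalEquality.Properties as ≡

import Algebra.Apartness.Properties.HeytingCommutativeRing as HeytingProperties
import Algebra.Definitions.RawSemiring as RawSemiringDefinitions
import Algebra.Properties.Ring as RingProperties
import Algebra.Properties.Semiring.Exp as ExpProperties
import Algebra.Properties.Semiring.Mult as MultProperties
import Algebra.Properties.Semiring.Sum as SumProperties
import Algebra.Solver.Ring.NaturalCoefficients.Default as SemiringSolver
import Relation.Binary.Reasoning.Setoid as SetoidReasoning

-- Binomial coefficients in the natural numbers.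

nC0≡1 : ∀ n → n C 0 ≡ 1
nC0≡1 n = ≡.trans (nCk≡nC[n∸k] {0} {n} z≤n) (nCn≡1 n)

nCk*k![n∸k]!≡n! : ∀ {n k} → k ≤ n → (n C k) ℕ.* (k ! ℕ.* (n ∸ k) !) ≡ n !
nCk*k![n∸k]!≡n! {n} {k} k≤n =
  ≡.trans (≡.cong (ℕ._* (k ! ℕ.* (n ∸ k) !)) (nCk≡n!/k![n-k]! k≤n)) (m/n*n≡m (k![n∸k]!∣n! k≤n))
  where instance _ = k ℕ.!* (n ∸ k) !≢0

-- Multiplied by `p ! * j ! * (n ∸ (p + j)) !`, both sides become `n !`: choosing `p + j` elements
-- and then `p` of them is counted by the same multinomial coefficient as choosing the `p` first.
-- The common factor is nonzero and cancels, so no division is involved.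
nC[p+j]*[p+j]Cp≡nCp*[n∸p]Cj : ∀ {n p j} → p ≤ n → j ≤ n ∸ p →
  (n C (p ℕ.+ j)) ℕ.* ((p ℕ.+ j) C p) ≡ (n C p) ℕ.* ((n ∸ p) C j)
nC[p+j]*[p+j]Cp≡nCp*[n∸p]Cj {n} {p} {j} p≤n j≤n∸p =
  ℕ.*-cancelʳ-≡ _ _ (p ! ℕ.* (j ! ℕ.* r !)) (begin
    A ℕ.* B ℕ.* (p ! ℕ.* (j ! ℕ.* r !))  ≡⟨ regroupˡ A B (p !) (j !) (r !) ⟩
    A ℕ.* (B ℕ.* (p ! ℕ.* j !) ℕ.* r !)  ≡⟨ ≡.cong (λ z → A ℕ.* (z ℕ.* r !)) B-fact ⟩
    A ℕ.* ((p ℕ.+ j) ! ℕ.* r !)          ≡⟨ nCk*k![n∸k]!≡n! p+j≤n ⟩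
    n !                                  ≡⟨ nCk*k![n∸k]!≡n! p≤n ⟨
    D ℕ.* (p ! ℕ.* (n ∸ p) !)            ≡⟨ ≡.cong (λ z → D ℕ.* (p ! ℕ.* z)) E-fact ⟨
    D ℕ.* (p ! ℕ.* (E ℕ.* (j ! ℕ.* r !)))  ≡⟨ regroupʳ D E (p !) (j !) (r !) ⟩
    D ℕ.* E ℕ.* (p ! ℕ.* (j ! ℕ.* r !))  ∎)
  where
  open ≡.≡-Reasoning
  r = n ∸ (p ℕ.+ j)
  A = n C (p ℕ.+ j)
  B = (p ℕ.+ j) C p
  D = n C p
  E = (n ∸ p) C j
  instance
    _ = p ℕ.!≢0
    _ = j ℕ.!* r !≢0
    _ = ℕ.m*n≢0 (p !) (j ! ℕ.* r !)
  regroupˡ : ∀ a b c d e → a ℕ.* b ℕ.* (c ℕ.* (d ℕ.* e)) ≡ a ℕ.* (b ℕ.* (c ℕ.* d) ℕ.* e)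
  regroupˡ a b c d e = solve (a ∷ b ∷ c ∷ d ∷ e ∷ [])
  regroupʳ : ∀ a b c d e → a ℕ.* (c ℕ.* (b ℕ.* (d ℕ.* e))) ≡ a ℕ.* b ℕ.* (c ℕ.* (d ℕ.* e))
  regroupʳ a b c d e = solve (a ∷ b ∷ c ∷ d ∷ e ∷ [])
  p+j≤n : p ℕ.+ j ≤ n
  p+j≤n = ≡.subst (p ℕ.+ j ≤_) (ℕ.m+[n∸m]≡n p≤n) (ℕ.+-monoʳ-≤ p j≤n∸p)
  B-fact : B ℕ.* (p ! ℕ.* j !) ≡ (p ℕ.+ j) !
  B-fact = ≡.trans (≡.cong (λ z → B ℕ.* (p ! ℕ.* z !)) (≡.sym (ℕ.m+n∸m≡n p j)))
                   (nCk*k![n∸k]!≡n! (ℕ.m≤m+n p j))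
  E-fact : E ℕ.* (j ! ℕ.* r !) ≡ (n ∸ p) !
  E-fact = ≡.trans (≡.cong (λ z → E ℕ.* (j ! ℕ.* z !)) (≡.sym (ℕ.∸-+-assoc n p j)))
                   (nCk*k![n∸k]!≡n! j≤n∸p)

-- Iterated differences and alternating binomial sums over a commutative ring.

module FiniteDifferences {c ℓ} (R : CommutativeRing c ℓ) where

  open CommutativeRing R hiding (zero)
  open RingProperties ring
  open MultProperties semiring using (×-homo-+; ×1-homo-*; ×-congˡ; ×-homo-1)
  open RawSemiringDefinitions (Semiring.rawSemiring semiring) using (_^_; product) renaming (_×_ to _·_)
  open SumProperties semiring using (sum; sum-cong-≋; sum-replicate-zero)
  open SemiringSolver commutativeSemiring using (_:+_; _:*_; _:=_) renaming (solve to solveSemiring)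
  open SetoidReasoning setoid

  -- diff N f = ((1 - E)ᴺ f)(0), where E is the shift.
  diff : ℕ → (ℕ → Carrier) → Carrier
  diff zero    f = f 0
  diff (suc N) f = diff N f - diff N (f ∘ suc)

  interchange : ∀ a b c d → (a + b) - (c + d) ≈ (a - c) + (b - d)
  interchange a b c d = trans (+-congˡ (sym (-‿+-comm c d)))
    (solveSemiring 4 (λ a b c d → ((a :+ b) :+ (c :+ d)) := ((a :+ c) :+ (b :+ d))) refl a b (- c) (- d))

  -‿cong₂ : ∀ {a b c d} → a ≈ c → b ≈ d → a - b ≈ c - d
  -‿cong₂ a≈c b≈d = +-cong a≈c (-‿cong b≈d)

  diff-+ : ∀ N f g → diff N (λ k → f k + g k) ≈ diff N f + diff N g
  diff-+ zero    f g = refl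
  diff-+ (suc N) f g = trans (-‿cong₂ (diff-+ N f g) (diff-+ N (f ∘ suc) (g ∘ suc))) (interchange _ _ _ _)

  diff-0 : ∀ N → diff N (λ _ → 0#) ≈ 0#
  diff-0 zero    = refl
  diff-0 (suc N) = -‿inverseʳ _

  diff-sum : ∀ N m (g : ℕ → ℕ → Carrier) →
    diff N (λ k → sum {m} (λ i → g (toℕ i) k)) ≈ sum {m} (λ i → diff N (g (toℕ i)))
  diff-sum N zero    g = diff-0 N
  diff-sum N (suc m) g = trans (diff-+ N (g 0) _) (+-congˡ (diff-sum N m (g ∘ suc)))

  -- The operator `1 - E` sends `f` to `- g` and commutes with the remaining `N` factors. Since
  -- `diff` unfolds into two differences of lower order, the hypothesis on `f` is used only when a
  -- single factor is left; the larger orders just carry the sign along.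
  diff-telescope : ∀ N f g → (∀ k → f (suc k) ≈ f k + g k) → diff (suc N) f ≈ - diff N g
  diff-telescope zero f g f-step = begin
    f 0 - f 1            ≈⟨ +-congˡ (-‿cong (f-step 0)) ⟩
    f 0 - (f 0 + g 0)    ≈⟨ +-congˡ (-‿+-comm _ _) ⟨
    f 0 + (- f 0 - g 0)  ≈⟨ +-assoc _ _ _ ⟨
    f 0 - f 0 - g 0      ≈⟨ +-congʳ (-‿inverseʳ _) ⟩
    0# - g 0             ≈⟨ +-identityˡ _ ⟩
    - g 0                ∎
  diff-telescope (suc N) f g f-step =
    trans (-‿cong₂ (diff-telescope N f g f-step) (diff-telescope N (f ∘ suc) (g ∘ suc) (f-step ∘ suc)))
          (-‿+-comm _ _)

  -- The length `L` is kept separate from the order `N` because Pascal's rule relates sums of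
  -- different lengths. Terms with index above `N` have a vanishing coefficient, so every `L > N`
  -- gives the full binomial sum.
  alternatingSum : ℕ → ℕ → (ℕ → Carrier) → Carrier
  alternatingSum N L f =
    sum {L} (λ j → (- 1#) ^ toℕ j * ((N C toℕ j) · 1#) * f (toℕ j))

  sum-≈0 : ∀ L (v : ℕ → Carrier) → (∀ k → v k ≈ 0#) → sum {L} (v ∘ toℕ) ≈ 0#
  sum-≈0 L v v≈0 = trans (sum-cong-≋ {L} (λ j → v≈0 (toℕ j))) (sum-replicate-zero L)

  sum-sub : ∀ L (v w : ℕ → Carrier) →
    sum {L} (λ j → v (toℕ j) - w (toℕ j)) ≈ sum {L} (v ∘ toℕ) - sum {L} (w ∘ toℕ)
  sum-sub zero    v w = sym (-‿inverseʳ 0#)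
  sum-sub (suc L) v w = trans (+-congˡ (sum-sub L (v ∘ suc) (w ∘ suc))) (sym (interchange _ _ _ _))

  -- Pascal's rule splits every term after the first. The half with the lower binomial index carries
  -- one extra factor `- 1#` and, reindexed from `0`, is the sum for the shifted sequence, one term
  -- shorter. This is the recursion that defines `diff`.
  alternatingSum-suc : ∀ N L f →
    alternatingSum (suc N) (suc L) f ≈ alternatingSum N (suc L) f - alternatingSum N L (f ∘ suc)
  alternatingSum-suc N L f = begin
    term (suc N) 0 + sum {L} (λ j → term (suc N) (suc (toℕ j)))
      ≈⟨ +-cong head (sum-cong-≋ {L} (λ j → pascal (toℕ j))) ⟩
    term N 0 + sum {L} (λ j → term N (suc (toℕ j)) - shifted (toℕ j))
      ≈⟨ +-congˡ (sum-sub L (term N ∘ suc) shifted) ⟩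
    term N 0 + (sum {L} (λ j → term N (suc (toℕ j))) - sum {L} (shifted ∘ toℕ))
      ≈⟨ +-assoc _ _ _ ⟨
    alternatingSum N (suc L) f - alternatingSum N L (f ∘ suc) ∎
    where
    term : ℕ → ℕ → Carrier
    term N k = (- 1#) ^ k * ((N C k) · 1#) * f k
    shifted : ℕ → Carrier
    shifted k = (- 1#) ^ k * ((N C k) · 1#) * f (suc k)
    head : term (suc N) 0 ≈ term N 0
    head = *-congʳ (*-congˡ (×-congˡ (≡.trans (nC0≡1 (suc N)) (≡.sym (nC0≡1 N)))))
    pascal : ∀ k → term (suc N) (suc k) ≈ term N (suc k) - shifted k
    pascal k = begin
      - 1# * e * ((suc N C suc k) · 1#) * f (suc k)
        ≈⟨ *-congʳ (*-congˡ (trans (×-congˡ (≡.sym (nCk+nC[k+1]≡[n+1]C[k+1] N k))) (×-homo-+ 1# (N C k) (N C suc k)))) ⟩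
      - 1# * e * (a + b) * f (suc k)
        ≈⟨ solveSemiring 5 (λ u e a b z → (u :* e :* (a :+ b) :* z)
             := (u :* e :* b :* z :+ u :* (e :* a :* z))) refl
             (- 1#) e a b (f (suc k)) ⟩
      - 1# * e * b * f (suc k) + - 1# * (e * a * f (suc k))
        ≈⟨ +-congˡ (-1*x≈-x _) ⟩
      term N (suc k) - shifted k ∎
      where
      e = (- 1#) ^ k
      a = (N C k) · 1#
      b = (N C suc k) · 1#

  alternatingSum≈diff : ∀ N L f → N < L → alternatingSum N L f ≈ diff N f
  alternatingSum≈diff zero (suc L) f _ = begin
    1# * (1 · 1#) * f 0 + sum {L} (λ j → tail (toℕ j))
      ≈⟨ +-cong head (sum-≈0 L tail tail≈0) ⟩
    f 0 + 0#
      ≈⟨ +-identityʳ _ ⟩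
    f 0 ∎
    where
    tail : ℕ → Carrier
    tail k = (- 1#) ^ suc k * ((0 C suc k) · 1#) * f (suc k)
    tail≈0 : ∀ k → tail k ≈ 0#
    -- `0 C suc k` computes to `0`, so the middle factor is `0#` by definition.
    tail≈0 k = trans (*-congʳ (zeroʳ _)) (zeroˡ _)
    head : 1# * (1 · 1#) * f 0 ≈ f 0
    head = trans (*-congʳ (trans (*-identityˡ _) (×-homo-1 1#))) (*-identityˡ _)
  alternatingSum≈diff (suc N) (suc L) f (s≤s N<L) =
    trans (alternatingSum-suc N L f)
      (-‿cong₂ (alternatingSum≈diff N (suc L) f (ℕ.m<n⇒m<1+n N<L)) (alternatingSum≈diff N L (f ∘ suc) N<L))

  -- Iterated differences of the reciprocals of an arithmetic progression.

  product-last : ∀ n (y : ℕ → Carrier) →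
    product {suc n} (y ∘ toℕ) ≈ product {n} (y ∘ toℕ) * y n
  product-last zero    y = *-comm _ _
  product-last (suc n) y = trans (*-congˡ (product-last n (y ∘ suc))) (sym (*-assoc _ _ _))

  arithmetic : ∀ d (y : ℕ → Carrier) → (∀ k → y (suc k) ≈ y k + d) → ∀ k → y k ≈ y 0 + (k · 1#) * d
  arithmetic d y y-step zero    = sym (trans (+-congˡ (zeroˡ d)) (+-identityʳ _))
  arithmetic d y y-step (suc k) = trans (y-step k) (trans (+-congʳ (arithmetic d y y-step k))
    (trans (+-assoc _ _ _) (+-congˡ (trans (+-comm _ _)
      (sym (trans (distribʳ d 1# (k · 1#)) (+-congʳ (*-identityˡ d))))))))

  -- Clearing denominators keeps the formula inside a commutative ring. In the induction step, the
  -- product of all `y k` without its last factor clears the difference of `r`, and without its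
  -- first factor that of the shifted `r`. Both give `N ! * d ^ N`, so what remains is the factor
  -- `y (suc N) - y 0`, which is `suc N` times `d`.
  diff-reciprocal : ∀ N d (y r : ℕ → Carrier) →
    (∀ k → y k * r k ≈ 1#) → (∀ k → y (suc k) ≈ y k + d) →
    product {suc N} (y ∘ toℕ) * diff N r ≈ ((N !) · 1#) * d ^ N
  diff-reciprocal zero d y r yr≈1 y-step = begin
    y 0 * 1# * r 0   ≈⟨ *-congʳ (*-identityʳ _) ⟩
    y 0 * r 0        ≈⟨ yr≈1 0 ⟩
    1#               ≈⟨ trans (*-identityʳ _) (×-homo-1 1#) ⟨
    (1 · 1#) * 1#    ∎
  diff-reciprocal (suc N) d y r yr≈1 y-step = begin
    P * (diff N r - diff N (r ∘ suc))
      ≈⟨ x[y-z]≈xy-xz _ _ _ ⟩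
    P * diff N r - P * diff N (r ∘ suc)
      ≈⟨ -‿cong₂ first second ⟩
    y (suc N) * K - y 0 * K
      ≈⟨ [y-z]x≈yx-zx _ _ _ ⟨
    (y (suc N) - y 0) * K
      ≈⟨ *-congʳ (trans (+-congʳ (arithmetic d y y-step (suc N))) (xyx⁻¹≈y (y 0) _)) ⟩
    (suc N · 1#) * d * (((N !) · 1#) * d ^ N)
      ≈⟨ solveSemiring 4 (λ a d b e → (a :* d :* (b :* e))
           := (a :* b :* (d :* e))) refl
           (suc N · 1#) d ((N !) · 1#) (d ^ N) ⟩
    (suc N · 1#) * ((N !) · 1#) * (d * d ^ N)
      ≈⟨ *-congʳ (×1-homo-* (suc N) (N !)) ⟨
    ((suc N !) · 1#) * d ^ suc N ∎
    where
    P = product {suc (suc N)} (y ∘ toℕ)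
    K = ((N !) · 1#) * d ^ N
    first : P * diff N r ≈ y (suc N) * K
    first = begin
      P * diff N r
        ≈⟨ *-congʳ (trans (product-last (suc N) y) (*-comm _ _)) ⟩
      y (suc N) * product {suc N} (y ∘ toℕ) * diff N r
        ≈⟨ *-assoc _ _ _ ⟩
      y (suc N) * (product {suc N} (y ∘ toℕ) * diff N r)
        ≈⟨ *-congˡ (diff-reciprocal N d y r yr≈1 y-step) ⟩
      y (suc N) * K ∎
    second : P * diff N (r ∘ suc) ≈ y 0 * K
    second = trans (*-assoc _ _ _)
      (*-congˡ (diff-reciprocal N d (y ∘ suc) (r ∘ suc) (yr≈1 ∘ suc) (y-step ∘ suc)))

  sum-split : ∀ a b (v : ℕ → Carrier) →
    sum {a ℕ.+ b} (v ∘ toℕ) ≈ sum {a} (v ∘ toℕ) + sum {b} (λ j → v (a ℕ.+ toℕ j))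
  sum-split zero    b v = sym (+-identityˡ _)
  sum-split (suc a) b v = trans (+-congˡ (sum-split a b (v ∘ suc))) (sym (+-assoc _ _ _))

  fromℕ-^ : ∀ m k → (m ℕ.^ k) · 1# ≈ (m · 1#) ^ k
  fromℕ-^ m zero    = ×-homo-1 1#
  fromℕ-^ m (suc k) = trans (×1-homo-* m (m ℕ.^ k)) (*-congˡ (fromℕ-^ m k))

-- Quotients and signs in a field, and the left-hand side as a difference.

module BinomialHarmonic {c ℓ₁ ℓ₂} (F : HeytingField c ℓ₁ ℓ₂) where

  open HeytingField F using (heytingCommutativeRing; _#_; #⇒invertible)
  open HeytingCommutativeRing heytingCommutativeRing using (commutativeRing)
  open HarmonicSums F
  open FiniteDifferences commutativeRing
  open CommutativeRing commutativeRing hiding (zero)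
  open HeytingProperties heytingCommutativeRing using (x-0≈x)
  open RingProperties ring
  open MultProperties semiring using (×-homo-+; ×1-homo-*; ×-congˡ)
  open ExpProperties semiring using (_^_; ^-homo-*)
  open RawSemiringDefinitions (Semiring.rawSemiring semiring) using (product)
  open SumProperties semiring using (sum; sum-cong-≋; *-distribˡ-sum)
  open SemiringSolver commutativeSemiring using (_:+_; _:*_; _:=_) renaming (solve to solveSemiring)
  open SetoidReasoning setoid

  *-inverseʳ : ∀ y (y#0 : y # 0#) → y * inverse y y#0 ≈ 1#
  *-inverseʳ y y#0 = trans (*-congʳ (sym (x-0≈x y))) (proj₂ (proj₂ (#⇒invertible y#0)))

  -- Turns identities with cleared denominators into quotients, whichever proof of apartness the
  -- quotient carries.
  /-unique : ∀ {y z w} (y#0 : y # 0#) → y * z ≈ w → z ≈ w / y [ y#0 ]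
  /-unique {y} {z} {w} y#0 yz≈w = begin
    z            ≈⟨ *-identityʳ z ⟨
    z * 1#       ≈⟨ *-congˡ (*-inverseʳ y y#0) ⟨
    z * (y * i)  ≈⟨ *-assoc _ _ _ ⟨
    z * y * i    ≈⟨ *-congʳ (trans (*-comm z y) yz≈w) ⟩
    w * i        ∎
    where i = inverse y y#0

  -1*-1≈1 : - 1# * - 1# ≈ 1#
  -1*-1≈1 = trans (-1*x≈-x (- 1#)) (-‿involutive 1#)

  -- Trades integer exponents for natural ones, to which the additive law for powers applies.
  -1^[k-1]≈-[-1]^k : ∀ k → -1^ (+ k ℤ.- + 1) ≈ - ((- 1#) ^ k)
  -- Here the exponent is `-1`, so the power is the inverse of `- 1#`; it is `- 1#` itself, because
  -- `- 1#` squares to `1#`.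
  -1^[k-1]≈-[-1]^k zero    = trans (*-identityʳ _)
    (sym (trans (/-unique -1#0 -1*-1≈1) (*-identityˡ _)))
  -1^[k-1]≈-[-1]^k (suc k) = begin
    (- 1#) ^ k                  ≈⟨ *-identityˡ _ ⟨
    1# * (- 1#) ^ k             ≈⟨ *-congʳ -1*-1≈1 ⟨
    - 1# * - 1# * (- 1#) ^ k    ≈⟨ *-assoc _ _ _ ⟩
    - 1# * (- 1# * (- 1#) ^ k)  ≈⟨ -1*x≈-x _ ⟩
    - ((- 1#) ^ suc k)          ∎

  -- The length `b ∸ a` sits in the index type of the sum. With a variable `d` in its place, an
  -- equation for the length can be matched on directly and no vector has to be transported.
  ∑-length : ∀ {a b d} (v : ℕ → Carrier) → b ∸ a ≡ d →
    sum-syntax a b v ≈ sum {d} (λ j → v (a ℕ.+ toℕ j))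
  ∑-length v ≡.refl = refl

  ∏-length : ∀ {a b d} (v : ℕ → Carrier) → b ∸ a ≡ d →
    product-syntax a b v ≈ product {d} (λ j → v (a ℕ.+ toℕ j))
  ∏-length v ≡.refl = refl

  -- After the substitution `k = p + j`, the product of the two binomials has a factor free of `j`,
  -- and so has the sign. The sequence `h` is arbitrary, and both cases of the theorem start from
  -- here.
  binomialSum≈diff : ∀ {n p} → p ≤ n → (h : ℕ → Carrier) →
    ∑[ p ≤ k < suc n ] ((-1^ (+ k ℤ.- + 1)) * fromℕ (n C k) * fromℕ (k C p) * h k)
      ≈ - ((- 1#) ^ p * fromℕ (n C p)) * diff (n ∸ p) (λ j → h (p ℕ.+ j))
  binomialSum≈diff {n} {p} p≤n h = begin
    ∑[ p ≤ k < suc n ] term k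
      ≈⟨ ∑-length term (ℕ.+-∸-assoc 1 p≤n) ⟩
    sum {suc N} (λ j → term (p ℕ.+ toℕ j))
      ≈⟨ sum-cong-≋ {suc N} (λ j → regroup (toℕ j) (Fin.toℕ≤pred[n] j)) ⟩
    sum {suc N} (λ j → c′ * ((- 1#) ^ toℕ j * fromℕ (N C toℕ j) * h (p ℕ.+ toℕ j)))
      ≈⟨ *-distribˡ-sum {suc N} c′ (λ j → (- 1#) ^ toℕ j * fromℕ (N C toℕ j) * h (p ℕ.+ toℕ j)) ⟨
    c′ * alternatingSum N (suc N) (λ j → h (p ℕ.+ j))
      -- The indices from `p` to `n` give `N + 1` terms, the least length that reaches the last
      -- nonzero coefficient of order `N`.
      ≈⟨ *-congˡ (alternatingSum≈diff N (suc N) _ ℕ.≤-refl) ⟩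
    c′ * diff N (λ j → h (p ℕ.+ j)) ∎
    where
    N = n ∸ p
    c′ = - ((- 1#) ^ p * fromℕ (n C p))
    term : ℕ → Carrier
    term k = (-1^ (+ k ℤ.- + 1)) * fromℕ (n C k) * fromℕ (k C p) * h k
    regroup : ∀ j → j ≤ N →
      term (p ℕ.+ j) ≈ c′ * ((- 1#) ^ j * fromℕ (N C j) * h (p ℕ.+ j))
    regroup j j≤N = begin
      (-1^ (+ (p ℕ.+ j) ℤ.- + 1)) * fromℕ (n C (p ℕ.+ j)) * fromℕ ((p ℕ.+ j) C p) * z
        ≈⟨ *-congʳ (*-assoc _ _ _) ⟩
      (-1^ (+ (p ℕ.+ j) ℤ.- + 1)) * (fromℕ (n C (p ℕ.+ j)) * fromℕ ((p ℕ.+ j) C p)) * z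
        ≈⟨ *-congʳ (*-cong sign binomials) ⟩
      - 1# * (e * e′) * (a * b) * z
        ≈⟨ solveSemiring 6 (λ u e e′ a b z → (u :* (e :* e′) :* (a :* b) :* z)
             := (u :* (e :* a) :* (e′ :* b :* z))) refl
             (- 1#) e e′ a b z ⟩
      - 1# * (e * a) * (e′ * b * z)
        ≈⟨ *-congʳ (-1*x≈-x _) ⟩
      c′ * (e′ * b * z) ∎
      where
      z = h (p ℕ.+ j)
      e = (- 1#) ^ p
      e′ = (- 1#) ^ j
      a = fromℕ (n C p)
      b = fromℕ (N C j)
      sign : -1^ (+ (p ℕ.+ j) ℤ.- + 1) ≈ - 1# * (e * e′)
      sign = trans (-1^[k-1]≈-[-1]^k (p ℕ.+ j))
        (trans (-‿cong (^-homo-* (- 1#) p j)) (sym (-1*x≈-x _)))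
      binomials : fromℕ (n C (p ℕ.+ j)) * fromℕ ((p ℕ.+ j) C p) ≈ a * b
      binomials = begin
        fromℕ (n C (p ℕ.+ j)) * fromℕ ((p ℕ.+ j) C p)
          ≈⟨ ×1-homo-* (n C (p ℕ.+ j)) ((p ℕ.+ j) C p) ⟨
        fromℕ ((n C (p ℕ.+ j)) ℕ.* ((p ℕ.+ j) C p))
          ≈⟨ ×-congˡ (nC[p+j]*[p+j]Cp≡nCp*[n∸p]Cj p≤n j≤N) ⟩
        fromℕ ((n C p) ℕ.* (N C j))
          ≈⟨ ×1-homo-* (n C p) (N C j) ⟩
        a * b ∎

  -- Differences of the harmonic sums along an arithmetic progression of indices.

  module _ (m s : ℕ) (x : Carrier) (x≠ : NotNegativeInteger x) where

    reciprocal : ℕ → Carrier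
    reciprocal k = 1# / (fromℕ (suc k) + x) [ k+x#0 x≠ (suc k) ]

    -- Reconciles the denominators as they appear in the products of the theorem with those in the
    -- definition of `H`, where the index is stored minus one.
    l+x+suc-j : ∀ l j → fromℕ l + x + fromℕ (suc j) ≈ fromℕ (suc (l ℕ.+ j)) + x
    l+x+suc-j l j = begin
      fromℕ l + x + (1# + fromℕ j)
        ≈⟨ solveSemiring 4 (λ l x o j → (l :+ x :+ (o :+ j))
             := (o :+ (l :+ j) :+ x)) refl
             (fromℕ l) x 1# (fromℕ j) ⟩
      1# + (fromℕ l + fromℕ j) + x
        ≈⟨ +-congʳ (+-congˡ (×-homo-+ 1# l j)) ⟨
      fromℕ (suc (l ℕ.+ j)) + x ∎

    index-step : ∀ k → m ℕ.* suc k ℕ.+ s ≡ m ℕ.* k ℕ.+ s ℕ.+ m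
    index-step k = solve (m ∷ k ∷ s ∷ [])

    H-step : ∀ k → H (+ (m ℕ.* suc k ℕ.+ s)) x x≠
      ≈ H (+ (m ℕ.* k ℕ.+ s)) x x≠ + sum {m} (λ i → reciprocal (m ℕ.* k ℕ.+ s ℕ.+ toℕ i))
    H-step k = trans (reflexive (≡.cong (λ l → H (+ l) x x≠) (index-step k)))
      -- At a nonnegative index `H` unfolds to a sum of `reciprocal` starting at `0`, so raising `k`
      -- by one appends a block of `m` terms.
      (sum-split (m ℕ.* k ℕ.+ s) m reciprocal)

    -- For a fixed offset `j` inside the block, the denominators form an arithmetic progression with
    -- step `m`. Its terms for `u` from `p` to `n - 1` are `M + 1` in number, exactly the factors
    -- that `diff-reciprocal` requires at order `M`.
    diff-reciprocal-∏ : ∀ {p n M} j → n ∸ p ≡ suc M →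
      diff M (λ k → reciprocal (m ℕ.* (p ℕ.+ k) ℕ.+ s ℕ.+ j))
        ≈ fromℕ (M !) * fromℕ m ^ M
          * (1# / (∏[ p ≤ u < n ] (fromℕ (m ℕ.* u ℕ.+ s) + x + fromℕ (suc j)))
                [ ∏#0 p n _ (λ u → l+x+i#0 x≠ (m ℕ.* u ℕ.+ s) (suc j)) ])
    diff-reciprocal-∏ {p} {n} {M} j n∸p≡1+M =
      trans (/-unique _ (trans (*-congʳ (∏-length y n∸p≡1+M))
              (diff-reciprocal M (fromℕ m) (λ k → y (p ℕ.+ k)) _ inverses y-step)))
            (*-congˡ (sym (*-identityˡ _)))
      where
      y : ℕ → Carrier
      y u = fromℕ (m ℕ.* u ℕ.+ s) + x + fromℕ (suc j)
      inverses : ∀ k → y (p ℕ.+ k) * reciprocal (m ℕ.* (p ℕ.+ k) ℕ.+ s ℕ.+ j) ≈ 1#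
      inverses k = trans (*-cong (l+x+suc-j (m ℕ.* (p ℕ.+ k) ℕ.+ s) j) (*-identityˡ _)) (*-inverseʳ _ _)
      y-step : ∀ k → y (p ℕ.+ suc k) ≈ y (p ℕ.+ k) + fromℕ m
      y-step k = begin
        fromℕ (m ℕ.* (p ℕ.+ suc k) ℕ.+ s) + x + fromℕ (suc j)
          ≈⟨ +-congʳ (+-congʳ (×-congˡ (≡.trans (≡.cong (λ u → m ℕ.* u ℕ.+ s) (ℕ.+-suc p k)) (index-step (p ℕ.+ k))))) ⟩
        fromℕ (l ℕ.+ m) + x + fromℕ (suc j)
          ≈⟨ +-congʳ (+-congʳ (×-homo-+ 1# l m)) ⟩
        fromℕ l + fromℕ m + x + fromℕ (suc j)
          ≈⟨ solveSemiring 4 (λ l m x j → (l :+ m :+ x :+ j)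
               := (l :+ x :+ j :+ m)) refl
               (fromℕ l) (fromℕ m) x (fromℕ (suc j)) ⟩
        fromℕ l + x + fromℕ (suc j) + fromℕ m ∎
        where l = m ℕ.* (p ℕ.+ k) ℕ.+ s

    -- Of the `M + 1` differences, one replaces the harmonic sum by minus a block of `m`
    -- reciprocals. The other `M` act on each reciprocal of the block separately, and all of these
    -- contribute the same constant `M ! * m ^ M`.
    diff-H : ∀ {p n M} → n ∸ p ≡ suc M →
      diff (n ∸ p) (λ k → H (+ (m ℕ.* (p ℕ.+ k) ℕ.+ s)) x x≠)
        ≈ - (fromℕ (M !) * fromℕ m ^ M
          * (∑[ 0 ≤ j < m ]
              (1# / (∏[ p ≤ u < n ] (fromℕ (m ℕ.* u ℕ.+ s) + x + fromℕ (suc j)))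
                  [ ∏#0 p n _ (λ u → l+x+i#0 x≠ (m ℕ.* u ℕ.+ s) (suc j)) ])))
    diff-H {p} {n} {M} n∸p≡1+M = begin
      diff (n ∸ p) f
        ≡⟨ ≡.cong (λ d → diff d f) n∸p≡1+M ⟩
      diff (suc M) f
        ≈⟨ diff-telescope M f (λ k → sum {m} (λ i → g (toℕ i) k)) f-step ⟩
      - diff M (λ k → sum {m} (λ i → g (toℕ i) k))
        ≈⟨ -‿cong (diff-sum M m g) ⟩
      - sum {m} (λ i → diff M (g (toℕ i)))
        ≈⟨ -‿cong (sum-cong-≋ {m} (λ i → diff-reciprocal-∏ (toℕ i) n∸p≡1+M)) ⟩
      - sum {m} _
        ≈⟨ -‿cong (*-distribˡ-sum {m} (fromℕ (M !) * fromℕ m ^ M) _) ⟨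
      - (fromℕ (M !) * fromℕ m ^ M * _) ∎
      where
      f : ℕ → Carrier
      f k = H (+ (m ℕ.* (p ℕ.+ k) ℕ.+ s)) x x≠
      g : ℕ → ℕ → Carrier
      g i k = reciprocal (m ℕ.* (p ℕ.+ k) ℕ.+ s ℕ.+ i)
      f-step : ∀ k → f (suc k) ≈ f k + sum {m} (λ i → g (toℕ i) k)
      f-step k = trans (reflexive (≡.cong (λ u → H (+ (m ℕ.* u ℕ.+ s)) x x≠) (ℕ.+-suc p k)))
        (H-step (p ℕ.+ k))

  -- Since `M` is `n - p - 1`, the factor `n - p` of the denominator completes `M !` to `(n - p) !`;
  -- with `p !` this clears `n C p` to `n !`.
  binomial-quotient : ∀ {p n M} → p ≤ n → n ∸ p ≡ suc M →
    (#0 : fromℕ ((n ∸ p) ℕ.* p !) # 0#) →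
    fromℕ (n C p) * fromℕ (M !) ≈ fromℕ (n !) / fromℕ ((n ∸ p) ℕ.* p !) [ #0 ]
  binomial-quotient {p} {n} {M} p≤n n∸p≡1+M #0 = /-unique #0 (begin
    fromℕ ((n ∸ p) ℕ.* p !) * (fromℕ (n C p) * fromℕ (M !))
      ≈⟨ *-congˡ (×1-homo-* (n C p) (M !)) ⟨
    fromℕ ((n ∸ p) ℕ.* p !) * fromℕ ((n C p) ℕ.* M !)
      ≈⟨ ×1-homo-* ((n ∸ p) ℕ.* p !) ((n C p) ℕ.* M !) ⟨
    fromℕ ((n ∸ p) ℕ.* p ! ℕ.* ((n C p) ℕ.* M !))
      ≈⟨ ×-congˡ factorials ⟩
    fromℕ (n !) ∎)
    where
    regroup : ∀ a b c d → a ℕ.* b ℕ.* (c ℕ.* d) ≡ c ℕ.* (b ℕ.* (a ℕ.* d))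
    regroup a b c d = solve (a ∷ b ∷ c ∷ d ∷ [])
    factorials : (n ∸ p) ℕ.* p ! ℕ.* ((n C p) ℕ.* M !) ≡ n !
    factorials = ≡.trans (regroup (n ∸ p) (p !) (n C p) (M !))
      (≡.trans (≡.cong (λ z → (n C p) ℕ.* (p ! ℕ.* z))
                  (≡.trans (≡.cong (ℕ._* M !) n∸p≡1+M) (≡.cong _! (≡.sym n∸p≡1+M))))
               (nCk*k![n∸k]!≡n! p≤n))

theorem1p2 : ∀ {c ℓ₁ ℓ₂} (F : HeytingField c ℓ₁ ℓ₂) →
  let open HeytingField F
      open HarmonicSums F
  in
  (char0 : CharacteristicZero) →
  (m s p n : ℕ) → p ≤ n → 1 ≤ m →
  (x : Carrier) (x≠ : NotNegativeInteger x) →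
  let lhs = ∑[ p ≤ k < suc n ]
              ((-1^ (+ k ℤ.- + 1)) * fromℕ (n C k) * fromℕ (k C p) * H (+ (m ℕ.* k ℕ.+ s)) x x≠)
  in
  ((p<n : p < n) →
    lhs ≈
      ((-1^ (+ p)) * fromℕ (m ℕ.^ (n ∸ p ∸ 1)) * fromℕ (n !))
        / fromℕ ((n ∸ p) ℕ.* p !) [ [n∸p]*p!#0 char0 p<n ]
      * (∑[ 0 ≤ j < m ]
          (1# / (∏[ p ≤ u < n ] (fromℕ (m ℕ.* u ℕ.+ s) + x + fromℕ (suc j)))
              [ ∏#0 p n _ (λ u → l+x+i#0 x≠ (m ℕ.* u ℕ.+ s) (suc j)) ])))
  ×
  (n ≡ p →
    lhs ≈ (-1^ (+ p ℤ.- + 1)) * H (+ (m ℕ.* p ℕ.+ s)) x x≠)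
theorem1p2 F char0 m s p n p≤n _ x x≠ = strict , equal
  where
  open HeytingField F using (heytingCommutativeRing)
  open HeytingCommutativeRing heytingCommutativeRing using (commutativeRing)
  open CommutativeRing commutativeRing hiding (zero)
  open HarmonicSums F
  open FiniteDifferences commutativeRing
  open BinomialHarmonic F
  open RingProperties ring
  open MultProperties semiring using (×-congˡ; ×-homo-1)
  open ExpProperties semiring using (_^_)
  open SemiringSolver commutativeSemiring using (_:*_; _:=_) renaming (solve to solveSemiring)
  open SetoidReasoning setoid

  h : ℕ → Carrier
  h k = H (+ (m ℕ.* k ℕ.+ s)) x x≠

  e = (- 1#) ^ p

  strict : (p<n : p < n) → _
  strict p<n = begin
    _
      ≈⟨ binomialSum≈diff p≤n h ⟩
    - (e * b) * diff (n ∸ p) (λ j → h (p ℕ.+ j))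
      ≈⟨ *-congˡ (diff-H m s x x≠ {p} {n} n∸p≡1+M) ⟩
    - (e * b) * - (fromℕ (M !) * fromℕ m ^ M * S)
      -- The minus sign of `(-1)^(p-1) = - (-1)^p` cancels the one produced by telescoping.
      ≈⟨ trans (trans (sym (-‿distribˡ-* _ _)) (-‿cong (sym (-‿distribʳ-* _ _)))) (-‿involutive _) ⟩
    e * b * (fromℕ (M !) * fromℕ m ^ M * S)
      ≈⟨ solveSemiring 5 (λ e b f w S → (e :* b :* (f :* w :* S))
           := (e :* w :* (b :* f) :* S)) refl
           e b (fromℕ (M !)) (fromℕ m ^ M) S ⟩
    e * fromℕ m ^ M * (b * fromℕ (M !)) * S
      ≈⟨ *-congʳ (*-cong (*-congˡ (sym (fromℕ-^ m M))) (binomial-quotient p≤n n∸p≡1+M ([n∸p]*p!#0 char0 p<n))) ⟩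
    e * fromℕ (m ℕ.^ M) * (fromℕ (n !) / fromℕ ((n ∸ p) ℕ.* p !) [ [n∸p]*p!#0 char0 p<n ]) * S
      -- A quotient is a product with an inverse, so associativity moves the other factors into the
      -- numerator; `-1^ (+ p)` unfolds to `e`.
      ≈⟨ *-congʳ (*-assoc _ _ _) ⟨
    e * fromℕ (m ℕ.^ M) * fromℕ (n !) / fromℕ ((n ∸ p) ℕ.* p !) [ [n∸p]*p!#0 char0 p<n ] * S ∎
    where
    M = n ∸ p ∸ 1
    n∸p≡1+M : n ∸ p ≡ suc M
    n∸p≡1+M = ≡.sym (ℕ.m+[n∸m]≡n (ℕ.m<n⇒0<n∸m p<n))
    b = fromℕ (n C p)
    S = ∑[ 0 ≤ j < m ]
          (1# / (∏[ p ≤ u < n ] (fromℕ (m ℕ.* u ℕ.+ s) + x + fromℕ (suc j)))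
              [ ∏#0 p n _ (λ u → l+x+i#0 x≠ (m ℕ.* u ℕ.+ s) (suc j)) ])

  equal : n ≡ p → _
  equal ≡.refl = begin
    _
      ≈⟨ binomialSum≈diff p≤n h ⟩
    - (e * fromℕ (p C p)) * diff (p ∸ p) (λ j → h (p ℕ.+ j))
      -- `p ∸ p` does not reduce for a variable `p`. Once it is rewritten to `0`, the difference of
      -- order `0` is just the value at `j = 0`.
      ≡⟨ ≡.cong (λ d → - (e * fromℕ (p C p)) * diff d (λ j → h (p ℕ.+ j))) (ℕ.n∸n≡0 p) ⟩
    - (e * fromℕ (p C p)) * h (p ℕ.+ 0)
      ≈⟨ *-cong (-‿cong (trans (*-congˡ (trans (×-congˡ (nCn≡1 p)) (×-homo-1 1#))) (*-identityʳ e)))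
                (reflexive (≡.cong h (ℕ.+-identityʳ p))) ⟩
    - e * h p
      ≈⟨ *-congʳ (-1^[k-1]≈-[-1]^k p) ⟨
    (-1^ (+ p ℤ.- + 1)) * h p ∎
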